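{- Let $n\ge1$, $T\in\mathbb{Z}_2^n$, and $$X=\{(0,0,0),(1,1,1),(2,2,2),(3,3,3),(0,1,2),(1,0,3),(2,3,0),(3,2,1)\}\subset\mathbb{Z}_4^3 .$$ Let $f:(\mathbb{Z}_2^n)^3\to\{0,1\}$ be defined by $f(x,y,z)=1$ if and only if $x+y+z=T$. Then $\alpha_3(f)$ is equal to the largest cardinality of an $X$-free subset of $\mathbb{Z}_4^n$.
   Context: A subset $W\subseteq\mathbb{Z}_4^n$ is $X$-free if for every three distinct members $\mathbf{x},\mathbf{y},\mathbf{z}\in W$ (taken in any order) there is an index $1\le i\le n$ for which $(x_i,y_i,z_i)\notin X$. In a product $X_1\times X_2\times X_3$ (here each factor is $\mathbb{Z}_2^n$), a cylinder in dimension $i$ is a subset closed under arbitrary changes of the $i$-th coordinate, and a cylinder intersection is a set $T_1\cap T_2\cap T_3$ with $T_i$ a cylinder in dimension $i$. $\alpha_3(f)$ is the largest cardinality of a cylinder intersection contained in $f^{ -1}(1)$. -}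

module Defs where

open import Data.Fin using (Fin)
open import Data.Fin.Patterns using (0F; 1F; 2F; 3F)
open import Data.List using (List; []; _∷_; length)
import Data.List.Membership.Propositional as List
open import Data.List.Relation.Unary.Unique.Propositional using (Unique)
open import Data.Nat using (ℕ; _≤_)
open import Data.Nat.Properties using (≤-antisym)
open import Data.Parity as ℙ using (Parity)
open import Data.Product using (Σ-syntax; ∃-syntax; _×_; _,_)
open import Data.Vec using (Vec; lookup; zipWith)
open import Function.Bundles using (_⇔_)
open import Level using (0ℓ; suc; _⊔_)
open import Relation.Binary.PropositionalEquality using (_≡_; _≢_)
open import Relation.Unary using (Pred; _∈_; _∉_; _⊆_; _∩_; _≐_)

-- The standard library's Parity is the two-element field.
ℤ₂^_ : ℕ → Set
ℤ₂^ n = Vec Parity n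

ℤ₄^_ : ℕ → Set
ℤ₄^ n = Vec (Fin 4) n

infixl 6 _⊕_
_⊕_ : ∀ {n} → ℤ₂^ n → ℤ₂^ n → ℤ₂^ n
_⊕_ = zipWith ℙ._+_

-- Subsets are arbitrary predicates, so membership proofs need not be unique;
-- a repetition-free list of the members counts elements rather than proofs.
HasCardinality : {A : Set} → Pred A 0ℓ → ℕ → Set
HasCardinality {A} S k =
  Σ[ xs ∈ List A ] Unique xs × (∀ x → (x List.∈ xs) ⇔ (x ∈ S)) × length xs ≡ k

-- m is the largest cardinality of a set belonging to the family 𝓕.
IsLargestCardinality : ∀ {ℓ} {A : Set} → (Pred A 0ℓ → Set ℓ) → ℕ → Set (suc 0ℓ ⊔ ℓ)
IsLargestCardinality 𝓕 m =
    (∃[ S ] 𝓕 S × HasCardinality S m)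
  × (∀ S k → 𝓕 S → HasCardinality S k → k ≤ m)

largest-unique : ∀ {ℓ} {A : Set} {𝓕 : Pred A 0ℓ → Set ℓ} {m m′} →
  IsLargestCardinality 𝓕 m → IsLargestCardinality 𝓕 m′ → m ≡ m′
largest-unique ((S , S∈𝓕 , ∣S∣) , max) ((S′ , S′∈𝓕 , ∣S′∣) , max′) =
  ≤-antisym (max′ S _ S∈𝓕 ∣S∣) (max S′ _ S′∈𝓕 ∣S′∣)

module _ {X₁ X₂ X₃ : Set} where

  IsCylinder₁ IsCylinder₂ IsCylinder₃ : Pred (X₁ × X₂ × X₃) 0ℓ → Set
  IsCylinder₁ T = ∀ x x′ y z → (x , y , z) ∈ T → (x′ , y , z) ∈ T
  IsCylinder₂ T = ∀ x y y′ z → (x , y , z) ∈ T → (x , y′ , z) ∈ T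
  IsCylinder₃ T = ∀ x y z z′ → (x , y , z) ∈ T → (x , y , z′) ∈ T

  IsCylinderIntersection : Pred (X₁ × X₂ × X₃) 0ℓ → Set₁
  IsCylinderIntersection S =
    ∃[ T₁ ] ∃[ T₂ ] ∃[ T₃ ]
      IsCylinder₁ T₁ × IsCylinder₂ T₂ × IsCylinder₃ T₃ × S ≐ (T₁ ∩ T₂ ∩ T₃)

  _⁻¹[_] : (X₁ × X₂ × X₃ → Fin 2) → Fin 2 → Pred (X₁ × X₂ × X₃) 0ℓ
  (f ⁻¹[ b ]) p = f p ≡ b

  -- α₃(f) = m
  Isα₃ : (X₁ × X₂ × X₃ → Fin 2) → ℕ → Set₁
  Isα₃ f = IsLargestCardinality λ S → IsCylinderIntersection S × S ⊆ f ⁻¹[ 1F ]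

IsXFree : Pred (Fin 4 × Fin 4 × Fin 4) 0ℓ → ∀ {n} → Pred (ℤ₄^ n) 0ℓ → Set
IsXFree X W = ∀ x y z → x ∈ W → y ∈ W → z ∈ W →
  x ≢ y → x ≢ z → y ≢ z →
  ∃[ i ] (lookup x i , lookup y i , lookup z i) ∉ X

X : Pred (Fin 4 × Fin 4 × Fin 4) 0ℓ
X = List._∈ (0F , 0F , 0F) ∷ (1F , 1F , 1F) ∷ (2F , 2F , 2F) ∷ (3F , 3F , 3F)
          ∷ (0F , 1F , 2F) ∷ (1F , 0F , 3F) ∷ (2F , 3F , 0F) ∷ (3F , 2F , 1F) ∷ []

{-# OPTIONS --safe #-}

-- Reading a digit of ℤ₄ as a pair of bits turns a word w of ℤ₄ⁿ into a point
-- (x , y) of (ℤ₂ⁿ)², hence into the point (x , y , T + x + y) of f⁻¹(1).  A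
-- subset of f⁻¹(1) is a cylinder intersection exactly when it contains no star
-- (x′ , y , z), (x , y′ , z), (x , y , z′) whose centre (x , y , z) lies outside
-- f⁻¹(1).  With d = x + y + z + T ≠ 0, the primes all stand for translation by d,
-- so seen in (ℤ₂ⁿ)² a star is a corner (x , y), (x + d , y), (x , y + d).  In one
-- coordinate the corners are precisely the eight triples of X: those with d = 0 are
-- the constant ones.
module Submission where

open import Defs
open import Data.Fin as Fin using (Fin; zero; suc)
open import Data.Fin.Patterns using (0F; 1F; 2F; 3F)
open import Data.Fin.Properties as Finₚ using (injective⇒≤; ¬∀⟶∃¬)
open import Data.List as List using (List; []; _∷_; length; cartesianProductWith)
open import Data.List.Membership.Propositional using (find; lose) renaming (_∈_ to _∈ₗ_)
open import Data.List.Membership.Propositional.Properties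
  using (∈-map⁺; ∈-map⁻; ∈-allFin; ∈-lookup; ∈-cartesianProductWith⁺)
open import Data.List.Membership.Setoid.Properties using (index-injective)
open import Data.List.Properties using (length-map; map-∘; map-id-local)
open import Data.List.Relation.Unary.All as All using ([]; _∷_)
open import Data.List.Relation.Unary.AllPairs using ([]; _∷_)
open import Data.List.Relation.Unary.Any as Any using (here)
open import Data.List.Relation.Unary.Unique.Propositional using (Unique)
import Data.List.Membership.DecPropositional as DecMembership
import Data.List.Relation.Unary.Unique.DecPropositional as DecUnique
import Data.List.Relation.Unary.Unique.Propositional.Properties as Unique
open import Data.Nat using (ℕ; zero; suc; _≤_; _≥_)
open import Data.Nat.Properties using (≤∧≢⇒<; ≤-pred)
open import Data.Parity as ℙ using (Parity; 0ℙ; 1ℙ)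
import Data.Parity.Properties as ℙₚ
open import Data.Product using (∃; ∃-syntax; _×_; _,_; proj₁; proj₂)
import Data.Product.Properties as Productₚ
open import Data.Vec as Vec using (Vec; []; _∷_; toList; fromList; lookup; zipWith)
open import Data.Vec.Properties as Vecₚ
  using (zipWith-assoc; zipWith-comm; toList∘fromList; length-toList)
open import Function using (_∘_; id; case_of_)
open import Function.Bundles using (_⇔_; mk⇔; Equivalence)
open import Level using (Level; 0ℓ)
open import Relation.Binary.Definitions using (DecidableEquality)
open import Relation.Binary.PropositionalEquality
  using (_≡_; _≢_; refl; sym; trans; cong; cong₂; subst; setoid)
open import Relation.Nullary using (Dec; yes; no; ¬?; contradiction)
open import Relation.Nullary.Decidable using (map′; from-yes; _×-dec_; _→-dec_)
open import Relation.Unary using (Pred; Decidable; _∈_; _⊆_; _≐_; _∩_)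

private
  variable
    ℓ ℓ′ : Level
    A B : Set
    k m n : ℕ

-- Cardinalities

-- The two maps need only be mutually inverse between `S` and `S′`. The image list has no repetition
-- because mapping `g` over it gives back `xs`.
HasCardinality-bijection : {S : Pred A 0ℓ} {S′ : Pred B 0ℓ} (f : A → B) (g : B → A) →
  (∀ {x} → x ∈ S → f x ∈ S′) → (∀ {y} → y ∈ S′ → g y ∈ S) →
  (∀ {x} → x ∈ S → g (f x) ≡ x) → (∀ {y} → y ∈ S′ → f (g y) ≡ y) →
  HasCardinality S k → HasCardinality S′ k
HasCardinality-bijection {S = S} {S′ = S′} f g f∈ g∈ gf fg (xs , unique , xs≐S , len) =
  List.map f xs , Unique.map⁻ (subst Unique (sym map-gf) unique) , members ,
  trans (length-map f xs) len
  where
  ∈xs⇒∈S : ∀ {x} → x ∈ₗ xs → x ∈ S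
  ∈xs⇒∈S = Equivalence.to (xs≐S _)

  map-gf : List.map g (List.map f xs) ≡ xs
  map-gf = trans (sym (map-∘ xs)) (map-id-local (All.tabulate (gf ∘ ∈xs⇒∈S)))

  members : ∀ y → (y ∈ₗ List.map f xs) ⇔ (y ∈ S′)
  members y = mk⇔
    (λ y∈ → case ∈-map⁻ f y∈ of λ { (x , x∈xs , refl) → f∈ (∈xs⇒∈S x∈xs) })
    (λ y∈ → subst (_∈ₗ _) (fg y∈) (∈-map⁺ f (Equivalence.from (xs≐S _) (g∈ y∈))))

IsLargestCardinality-transfer : {𝓕 : Pred (Pred A 0ℓ) ℓ} {𝓖 : Pred (Pred B 0ℓ) ℓ′} →
  (∀ S k → 𝓕 S → HasCardinality S k → ∃[ S′ ] 𝓖 S′ × HasCardinality S′ k) →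
  (∀ S k → 𝓖 S → HasCardinality S k → ∃[ S′ ] 𝓕 S′ × HasCardinality S′ k) →
  IsLargestCardinality 𝓕 m → IsLargestCardinality 𝓖 m
IsLargestCardinality-transfer 𝓕⇒𝓖 𝓖⇒𝓕 ((S , S∈𝓕 , ∣S∣) , max) =
  𝓕⇒𝓖 S _ S∈𝓕 ∣S∣ ,
  λ S′ k S′∈𝓖 ∣S′∣ → case 𝓖⇒𝓕 S′ k S′∈𝓖 ∣S′∣ of λ { (S″ , S″∈𝓕 , ∣S″∣) → max S″ k S″∈𝓕 ∣S″∣ }

-- Existence of the largest cardinality

greatest : {P : Pred ℕ ℓ} → Decidable P → P 0 → ∀ N → (∀ k → P k → k ≤ N) →
  ∃[ m ] P m × (∀ k → P k → k ≤ m)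
greatest P? P0 zero    bound = 0 , P0 , bound
greatest P? P0 (suc N) bound with P? (suc N)
... | yes PN = suc N , PN , bound
... | no ¬PN = greatest P? P0 N λ k Pk →
  -- Once `P (suc N)` is refuted, the bound drops to `N`.
  ≤-pred (≤∧≢⇒< (bound k Pk) λ { refl → ¬PN Pk })

Unique⇒lookup-injective : {xs : List A} → Unique xs →
  ∀ i j → List.lookup xs i ≡ List.lookup xs j → i ≡ j
Unique⇒lookup-injective (_ ∷ _)  zero    zero    _  = refl
Unique⇒lookup-injective (x∉ ∷ _) zero    (suc j) eq = contradiction eq (All.lookup x∉ (∈-lookup j))
Unique⇒lookup-injective (x∉ ∷ _) (suc i) zero    eq = contradiction (sym eq) (All.lookup x∉ (∈-lookup i))
Unique⇒lookup-injective (_ ∷ u)  (suc i) (suc j) eq = cong suc (Unique⇒lookup-injective u i j eq)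

vectors : List A → ∀ n → List (Vec A n)
vectors xs zero    = [] ∷ []
vectors xs (suc n) = cartesianProductWith _∷_ xs (vectors xs n)

module _ {univ : List A} (∈-univ : ∀ x → x ∈ₗ univ) where

  ∈-vectors : (v : Vec A n) → v ∈ₗ vectors univ n
  ∈-vectors []      = here refl
  ∈-vectors (x ∷ v) = ∈-cartesianProductWith⁺ _∷_ (∈-univ x) (∈-vectors v)

  ∃? : {P : Pred A ℓ} → Decidable P → Dec (∃ P)
  ∃? P? = map′ (λ any → case find any of λ { (x , _ , Px) → x , Px })
               (λ { (x , Px) → lose (∈-univ x) Px })
               (Any.any? P? univ)

  -- Pigeonhole: sending a position of `xs` to the position of its entry in `univ` is injective.
  Unique⇒length≤ : {xs : List A} → Unique xs → length xs ≤ length univ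
  Unique⇒length≤ {xs} unique = injective⇒≤ {f = λ i → Any.index (∈-univ (List.lookup xs i))}
    λ {i} {j} eq → Unique⇒lookup-injective unique i j
      (index-injective (setoid A) (∈-univ _) (∈-univ _) eq)

module _ {univ : List A} (∈-univ : ∀ x → x ∈ₗ univ) (_≟_ : DecidableEquality A) where

  -- A set with a cardinality has the same members as a repetition-free list, and `resp` passes
  -- between the two. Such lists are no longer than `univ`, so a finite search finds the maximum.
  largest-exists : (𝓕 : Pred (Pred A 0ℓ) ℓ) →
    (∀ {S S′} → S ≐ S′ → 𝓕 S → 𝓕 S′) →
    (∀ xs → Dec (𝓕 (_∈ₗ xs))) → 𝓕 (_∈ₗ []) →
    ∃[ m ] IsLargestCardinality 𝓕 m
  largest-exists 𝓕 resp 𝓕? 𝓕[] =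
    case greatest listed? ([] , [] , 𝓕[]) (length univ) bounded of λ
      { (m , (v , unique , v∈𝓕) , max) → m ,
          (_ , v∈𝓕 , toList v , unique , (λ _ → mk⇔ id id) , length-toList v) ,
          λ S k S∈𝓕 ∣S∣ → max k (list S∈𝓕 ∣S∣) }
    where
    Listed : Pred ℕ _
    Listed k = ∃[ v ] Unique (toList {n = k} v) × 𝓕 (_∈ₗ toList v)

    listed? : Decidable Listed
    listed? k = ∃? (∈-vectors ∈-univ) λ v → DecUnique.unique? _≟_ (toList v) ×-dec 𝓕? (toList v)

    bounded : ∀ k → Listed k → k ≤ length univ
    bounded k (v , unique , _) =
      subst (_≤ _) (length-toList v) (Unique⇒length≤ ∈-univ unique)

    list : ∀ {S k} → 𝓕 S → HasCardinality S k → Listed k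
    list S∈𝓕 (xs , unique , xs≐S , refl) = fromList xs ,
      subst (λ ys → Unique ys × 𝓕 (_∈ₗ ys)) (sym (toList∘fromList xs))
        (unique , resp ((λ {x} → Equivalence.from (xs≐S x)) , (λ {x} → Equivalence.to (xs≐S x))) S∈𝓕)

-- Decidability of X-freeness

_≟₄_ : DecidableEquality (ℤ₄^ n)
_≟₄_ = Vecₚ.≡-dec Fin._≟_

X? : Decidable X
X? p = DecMembership._∈?_ (Productₚ.≡-dec Fin._≟_ (Productₚ.≡-dec Fin._≟_ Fin._≟_)) p _

IsXFree-resp-≐ : {W W′ : Pred (ℤ₄^ n) 0ℓ} → W ≐ W′ → IsXFree X W → IsXFree X W′
IsXFree-resp-≐ (_ , W′⊆W) free x y z x∈ y∈ z∈ = free x y z (W′⊆W x∈) (W′⊆W y∈) (W′⊆W z∈)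

IsXFree? : (ws : List (ℤ₄^ n)) → Dec (IsXFree X (_∈ₗ ws))
IsXFree? ws = map′
  (λ free x y z x∈ y∈ z∈ → All.lookup (All.lookup (All.lookup free x∈) y∈) z∈)
  (λ free → All.tabulate λ x∈ → All.tabulate λ y∈ → All.tabulate λ z∈ → free _ _ _ x∈ y∈ z∈)
  (All.all? (λ x → All.all? (λ y → All.all? (λ z →
    ¬? (x ≟₄ y) →-dec ¬? (x ≟₄ z) →-dec ¬? (y ≟₄ z) →-dec
    Finₚ.any? (λ i → ¬? (X? (lookup x i , lookup y i , lookup z i)))) ws) ws) ws)

-- Planes x + y + z = T in ℤ₂ⁿ

⊕-rotate : (x y z : ℤ₂^ n) → x ⊕ y ⊕ z ≡ y ⊕ z ⊕ x
⊕-rotate x y z = trans (zipWith-assoc ℙₚ.+-assoc x y z) (zipWith-comm ℙₚ.+-comm x (y ⊕ z))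

⊕-cancel : (x y : ℤ₂^ n) → x ⊕ y ⊕ x ≡ y
⊕-cancel []       []       = refl
⊕-cancel (p ∷ x) (q ∷ y) = cong₂ _∷_ (+-cancel p q) (⊕-cancel x y)
  where
  +-cancel : ∀ p q → p ℙ.+ q ℙ.+ p ≡ q
  +-cancel 0ℙ 0ℙ = refl
  +-cancel 0ℙ 1ℙ = refl
  +-cancel 1ℙ 0ℙ = refl
  +-cancel 1ℙ 1ℙ = refl

module Plane (T : ℤ₂^ n) where

  -- Subtraction is addition in characteristic 2, so this is the unique z with x + y + z = T.
  -- Together with `rotate` it recovers any coordinate from the other two.
  third : ℤ₂^ n → ℤ₂^ n → ℤ₂^ n
  third x y = T ⊕ (x ⊕ y)

  ⊕≡⇒third : ∀ {x y z} → x ⊕ y ⊕ z ≡ T → third x y ≡ z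
  ⊕≡⇒third {x} {y} {z} refl = ⊕-cancel (x ⊕ y) z

  third⇒⊕≡ : ∀ {x y z} → third x y ≡ z → x ⊕ y ⊕ z ≡ T
  third⇒⊕≡ {x} {y} refl =
    trans (sym (zipWith-assoc ℙₚ.+-assoc (x ⊕ y) T (x ⊕ y))) (⊕-cancel (x ⊕ y) T)

  rotate : ∀ {x y z} → x ⊕ y ⊕ z ≡ T → y ⊕ z ⊕ x ≡ T
  rotate {x} {y} {z} = trans (sym (⊕-rotate x y z))

-- Digits as pairs of bits

lo hi : Fin 4 → Parity
lo 0F = 0ℙ
lo 1F = 1ℙ
lo 2F = 0ℙ
lo 3F = 1ℙ
hi 0F = 0ℙ
hi 1F = 0ℙ
hi 2F = 1ℙ
hi 3F = 1ℙ

digit : Parity → Parity → Fin 4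
digit 0ℙ 0ℙ = 0F
digit 1ℙ 0ℙ = 1F
digit 0ℙ 1ℙ = 2F
digit 1ℙ 1ℙ = 3F

los his : ℤ₄^ n → ℤ₂^ n
los = Vec.map lo
his = Vec.map hi

digits : ℤ₂^ n → ℤ₂^ n → ℤ₄^ n
digits = zipWith digit

digits-los-his : (w : ℤ₄^ n) → digits (los w) (his w) ≡ w
digits-los-his []       = refl
digits-los-his (0F ∷ w) = cong (0F ∷_) (digits-los-his w)
digits-los-his (1F ∷ w) = cong (1F ∷_) (digits-los-his w)
digits-los-his (2F ∷ w) = cong (2F ∷_) (digits-los-his w)
digits-los-his (3F ∷ w) = cong (3F ∷_) (digits-los-his w)

lo-digit : ∀ p q → lo (digit p q) ≡ p
lo-digit 0ℙ 0ℙ = refl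
lo-digit 0ℙ 1ℙ = refl
lo-digit 1ℙ 0ℙ = refl
lo-digit 1ℙ 1ℙ = refl

hi-digit : ∀ p q → hi (digit p q) ≡ q
hi-digit 0ℙ 0ℙ = refl
hi-digit 0ℙ 1ℙ = refl
hi-digit 1ℙ 0ℙ = refl
hi-digit 1ℙ 1ℙ = refl

los-digits : (x y : ℤ₂^ n) → los (digits x y) ≡ x
los-digits []      []      = refl
los-digits (p ∷ x) (q ∷ y) = cong₂ _∷_ (lo-digit p q) (los-digits x y)

his-digits : (x y : ℤ₂^ n) → his (digits x y) ≡ y
his-digits []      []      = refl
his-digits (p ∷ x) (q ∷ y) = cong₂ _∷_ (hi-digit p q) (his-digits x y)

-- X as the set of corners

IsXTriple : ℤ₄^ n → ℤ₄^ n → ℤ₄^ n → Set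
IsXTriple a b c = ∀ i → (lookup a i , lookup b i , lookup c i) ∈ X

-- The last equation expresses that both legs of the corner are shifted by the same d; it makes the
-- points of the second and third words share their third coordinate.
X⇒corner : ∀ {p q r} → (p , q , r) ∈ X →
  lo p ≡ lo r × hi p ≡ hi q × lo q ℙ.+ hi q ≡ lo r ℙ.+ hi r
X⇒corner = All.lookup
  {P = λ { (p , q , r) → lo p ≡ lo r × hi p ≡ hi q × lo q ℙ.+ hi q ≡ lo r ℙ.+ hi r }}
  (e ∷ e ∷ e ∷ e ∷ (refl , refl , refl) ∷ (refl , refl , refl) ∷
   (refl , refl , refl) ∷ (refl , refl , refl) ∷ [])
  where
  e : ∀ {u v w : Parity} → u ≡ u × v ≡ v × w ≡ w
  e = refl , refl , refl

IsXTriple⇒corner : (a b c : ℤ₄^ n) → IsXTriple a b c →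
  los a ≡ los c × his a ≡ his b × los b ⊕ his b ≡ los c ⊕ his c
IsXTriple⇒corner []      []      []      _   = refl , refl , refl
IsXTriple⇒corner (_ ∷ a) (_ ∷ b) (_ ∷ c) abc =
  let p , q , r    = X⇒corner (abc zero)
      ps , qs , rs = IsXTriple⇒corner a b c (abc ∘ suc)
  in cong₂ _∷_ p ps , cong₂ _∷_ q qs , cong₂ _∷_ r rs

∀-Parity? : {P : Pred Parity ℓ} → Decidable P → Dec (∀ p → P p)
∀-Parity? P? = map′ (λ { (P0 , P1) 0ℙ → P0 ; (P0 , P1) 1ℙ → P1 })
                    (λ ∀P → ∀P 0ℙ , ∀P 1ℙ)
                    (P? 0ℙ ×-dec P? 1ℙ)

-- With d = t + p + q + r, the two new bits are p + d and q + d. The sixteen cases are settled by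
-- evaluation.
corner∈X : ∀ t p q r →
  (digit p q , digit (t ℙ.+ (q ℙ.+ r)) q , digit p (t ℙ.+ (r ℙ.+ p))) ∈ X
corner∈X = from-yes
  (∀-Parity? λ t → ∀-Parity? λ p → ∀-Parity? λ q → ∀-Parity? λ r →
    X? (digit p q , digit (t ℙ.+ (q ℙ.+ r)) q , digit p (t ℙ.+ (r ℙ.+ p))))

corner-IsXTriple : (T x y z : ℤ₂^ n) → let open Plane T in
  IsXTriple (digits x y) (digits (third y z) y) (digits x (third z x))
corner-IsXTriple (t ∷ T) (p ∷ x) (q ∷ y) (r ∷ z) zero    = corner∈X t p q r
corner-IsXTriple (t ∷ T) (p ∷ x) (q ∷ y) (r ∷ z) (suc i) = corner-IsXTriple T x y z i

-- Cylinder intersections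

-- The i-th point differs from the centre only in coordinate i, so the i-th cylinder contains the
-- centre along with it.
star-centre : {X₁ X₂ X₃ : Set} {S : Pred (X₁ × X₂ × X₃) 0ℓ} → IsCylinderIntersection S →
  ∀ {x x′ y y′ z z′} → (x′ , y , z) ∈ S → (x , y′ , z) ∈ S → (x , y , z′) ∈ S → (x , y , z) ∈ S
star-centre (_ , _ , _ , cyl₁ , cyl₂ , cyl₃ , S⊆∩ , ∩⊆S) p₁ p₂ p₃ =
  ∩⊆S ( cyl₁ _ _ _ _ (proj₁ (S⊆∩ p₁))
      , cyl₂ _ _ _ _ (proj₁ (proj₂ (S⊆∩ p₂)))
      , cyl₃ _ _ _ _ (proj₂ (proj₂ (S⊆∩ p₃))))

module Correspondence (T : ℤ₂^ n) where
  open Plane T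

  plane : Pred (ℤ₂^ n × ℤ₂^ n × ℤ₂^ n) 0ℓ
  plane (x , y , z) = x ⊕ y ⊕ z ≡ T

  point : ℤ₄^ n → ℤ₂^ n × ℤ₂^ n × ℤ₂^ n
  point w = los w , his w , third (los w) (his w)

  word : ℤ₂^ n × ℤ₂^ n × ℤ₂^ n → ℤ₄^ n
  word (x , y , _) = digits x y

  word-point : ∀ w → word (point w) ≡ w
  word-point = digits-los-his

  point-word : ∀ {p} → p ∈ plane → point (word p) ≡ p
  point-word {x , y , z} p∈plane
    rewrite los-digits x y | his-digits x y | ⊕≡⇒third p∈plane = refl

  point∈plane : ∀ w → point w ∈ plane
  point∈plane w = third⇒⊕≡ {los w} {his w} refl

  -- If every index gave a triple of `X`, the points of b, c and a would form a star in `S`. Its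
  -- centre would lie in `S`, hence on the plane, forcing a = b.
  cylinderIntersection⇒XFree : ∀ {S} → IsCylinderIntersection S → S ⊆ plane →
    IsXFree X (λ w → point w ∈ S)
  cylinderIntersection⇒XFree {S} cyl S⊆plane a b c a∈ b∈ c∈ a≢b _ _ =
    -- As `X` is decidable and the indices are finite in number, refuting the universal claim
    -- produces an index.
    ¬∀⟶∃¬ n _ (λ i → X? _) (a≢b ∘ a≡b)
    where
    a≡b : IsXTriple a b c → a ≡ b
    a≡b abc = trans (sym (digits-los-his a))
             (trans (cong₂ digits losa≡losb hisa≡hisb) (digits-los-his b))
      where
      corner = IsXTriple⇒corner a b c abc
      losa≡losc = proj₁ corner
      hisa≡hisb = proj₁ (proj₂ corner)
      z = third (los b) (his b)

      centre∈S : (los a , his a , z) ∈ S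
      centre∈S = star-centre cyl
        (subst (λ y → (los b , y , z) ∈ S) (sym hisa≡hisb) b∈)
        (subst (_∈ S)
          (cong₂ (λ x u → x , his c , T ⊕ u) (sym losa≡losc) (sym (proj₂ (proj₂ corner)))) c∈)
        a∈

      -- The centre and the point of b lie on the plane and agree in their last two coordinates,
      -- which determine the first.
      losa≡losb : los a ≡ los b
      losa≡losb = trans (sym (⊕≡⇒third (rotate (S⊆plane centre∈S))))
                 (trans (cong (λ y → third y z) hisa≡hisb)
                        (⊕≡⇒third (rotate (point∈plane b))))

  module _ (W : Pred (ℤ₄^ n) 0ℓ) where

    -- The cylinder in dimension i of the points whose projection along i to the
    -- plane lies over W.
    cylinder₁ cylinder₂ cylinder₃ cylinders : Pred (ℤ₂^ n × ℤ₂^ n × ℤ₂^ n) 0ℓ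
    cylinder₁ (x , y , z) = digits (third y z) y ∈ W
    cylinder₂ (x , y , z) = digits x (third z x) ∈ W
    cylinder₃ (x , y , z) = digits x y ∈ W
    cylinders = cylinder₁ ∩ cylinder₂ ∩ cylinder₃

    cylinders-IsCylinderIntersection : IsCylinderIntersection cylinders
    cylinders-IsCylinderIntersection = cylinder₁ , cylinder₂ , cylinder₃ ,
      (λ _ _ _ _ → id) , (λ _ _ _ _ → id) , (λ _ _ _ _ → id) , id , id

    -- For a point already on the plane all three projections give back w.
    point∈cylinders : ∀ {w} → w ∈ W → point w ∈ cylinders
    point∈cylinders {w} w∈
      rewrite ⊕≡⇒third (rotate (point∈plane w))
            | ⊕≡⇒third (rotate (rotate (point∈plane w)))
            | digits-los-his w = w∈ , w∈ , w∈

    -- Off the plane d is nonzero, so the three projections are pairwise distinct members of `W`.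
    -- They form a triple of `X` at every index, contradicting freeness.
    cylinders⊆plane : IsXFree X W → cylinders ⊆ plane
    cylinders⊆plane free {x , y , z} (b∈ , c∈ , a∈) with Vecₚ.≡-dec ℙₚ._≟_ (x ⊕ y ⊕ z) T
    ... | yes p∈plane = p∈plane
    ... | no  p∉plane = case free _ _ _ a∈ b∈ c∈ a≢b a≢c b≢c of λ
      { (i , ∉X) → contradiction (corner-IsXTriple T x y z i) ∉X }
      where
      x≢ : x ≢ third y z
      x≢ eq = p∉plane (rotate (rotate (third⇒⊕≡ (sym eq))))

      y≢ : y ≢ third z x
      y≢ eq = p∉plane (rotate (third⇒⊕≡ (sym eq)))

      los-≡ : ∀ {x y x′ y′ : ℤ₂^ n} → digits x y ≡ digits x′ y′ → x ≡ x′
      los-≡ eq = trans (sym (los-digits _ _)) (trans (cong los eq) (los-digits _ _))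

      his-≡ : ∀ {x y x′ y′ : ℤ₂^ n} → digits x y ≡ digits x′ y′ → y ≡ y′
      his-≡ eq = trans (sym (his-digits _ _)) (trans (cong his eq) (his-digits _ _))

      a≢b : digits x y ≢ digits (third y z) y
      a≢b = x≢ ∘ los-≡

      a≢c : digits x y ≢ digits x (third z x)
      a≢c = y≢ ∘ his-≡

      b≢c : digits (third y z) y ≢ digits x (third z x)
      b≢c = x≢ ∘ sym ∘ los-≡

-- Transfer of the maximum between the two families

theorem19 : (n : ℕ) → n ≥ 1 → (T : ℤ₂^ n) →
    (f : ℤ₂^ n × ℤ₂^ n × ℤ₂^ n → Fin 2) →
    (∀ x y z → (f (x , y , z) ≡ 1F) ⇔ (x ⊕ y ⊕ z ≡ T)) →
    ∃[ m ] (Isα₃ f m × IsLargestCardinality (IsXFree X {n}) m)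
theorem19 n _ T f f⇔plane =
  -- The maximum is found on the X-free side, where freeness of a listed set is decidable; the empty
  -- set is vacuously free.
  let m , m-largest = largest-exists (∈-vectors (∈-allFin {4})) _≟₄_
                        (IsXFree X {n}) IsXFree-resp-≐ IsXFree? (λ _ _ _ ())
  in m , IsLargestCardinality-transfer XFree⇒cylinder cylinder⇒XFree m-largest , m-largest
  where
  open Correspondence T

  XFree⇒cylinder : ∀ W k → IsXFree X W → HasCardinality W k →
    ∃[ S ] (IsCylinderIntersection S × S ⊆ f ⁻¹[ 1F ]) × HasCardinality S k
  XFree⇒cylinder W k free ∣W∣ =
    cylinders W ,
    (cylinders-IsCylinderIntersection W ,
      λ p∈ → Equivalence.from (f⇔plane _ _ _) (cylinders⊆plane W free p∈)) ,
    -- Membership in `cylinder₃` says precisely that the word of the point lies in `W`.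
    HasCardinality-bijection point word (point∈cylinders W) (proj₂ ∘ proj₂)
      (λ _ → word-point _) (point-word ∘ cylinders⊆plane W free) ∣W∣

  cylinder⇒XFree : ∀ S k → IsCylinderIntersection S × S ⊆ f ⁻¹[ 1F ] → HasCardinality S k →
    ∃[ W ] IsXFree X W × HasCardinality W k
  cylinder⇒XFree S k (cyl , S⊆f⁻¹1) ∣S∣ =
    (λ w → point w ∈ S) ,
    cylinderIntersection⇒XFree cyl S⊆plane ,
    HasCardinality-bijection word point
      (λ p∈ → subst (_∈ S) (sym (point-word (S⊆plane p∈))) p∈) id
      (point-word ∘ S⊆plane) (λ _ → word-point _) ∣S∣
    where
    S⊆plane : S ⊆ plane
    S⊆plane p∈ = Equivalence.to (f⇔plane _ _ _) (S⊆f⁻¹1 p∈)
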